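{- Let $\ell$ be an odd prime, let $t\ge2$ be an integer, and let $\alpha\in\mathbb{Z}_\ell^t\setminus(\ell\mathbb{Z}_\ell)^t$ be an admissible vector. If $\ell>t$, then $\lambda_\ell(X_t,\alpha)<2t$.
   Context: For $b\in\mathbb{Z}_\ell$ put $\binom{b}{n}=\frac{b(b-1)\cdots(b-n+1)}{n!}\in\mathbb{Z}_\ell$ and $(1+T)^b=\sum_{n\ge0}\binom{b}{n}T^n\in\mathbb{Z}_\ell[[T]]$. The bouquet $X_t$ is the multigraph with one vertex and $t$ undirected loops; a vector $\alpha=(\alpha_1,\dots,\alpha_t)\in\mathbb{Z}_\ell^t$ assigns the voltage $\alpha_j$ to the $j$-th loop. It is admissible if $\alpha\in\mathbb{Z}_\ell^t\setminus(\ell\mathbb{Z}_\ell)^t$. The characteristic series is $$f(T)=f_{X_t,\alpha}(T)=\sum_{j=1}^t\big(2-(1+T)^{\alpha_j}-(1+T)^{ -\alpha_j}\big)\in\mathbb{Z}_\ell[[T]].$$ For admissible $\alpha$ it is nonzero, and it has zero constant term. By Weierstrass preparation write $f(T)=\ell^{\mu}g(T)u(T)$ with $\mu\in\mathbb{Z}_{\ge0}$, $g$ a distinguished polynomial (monic, all non-leading coefficients divisible by $\ell$) and $u\in\mathbb{Z}_\ell[[T]]^\times$. Then $\mu_\ell(X_t,\alpha):=\mu$ and $\lambda_\ell(X_t,\alpha):=\deg g-1$ (note the shift by $-1$). -}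

module Defs where

open import Algebra.Bundles using (CommutativeRing; Semiring)
import Algebra.Definitions as AlgebraDefinitions
import Algebra.Definitions.RawSemiring as RawSemiringDefinitions
open import Data.Fin.Base using (toℕ)
open import Data.Integer.Base as ℤ using (ℤ; +_; -[1+_]; 0ℤ; 1ℤ)
import Data.Integer.Properties as ℤ
open import Data.Integer.Divisibility.Signed
  using (∣ᵤ⇒∣; ∣⇒∣ᵤ; ∣m∣n⇒∣m+n; ∣m+n∣n⇒∣m; ∣m⇒∣-m; ∣m⇒∣m*n; ∣n⇒∣m*n; ∣-trans; *-monoʳ-∣)
  renaming (_∣_ to _∣ℤ_; divides to dividesℤ)
open import Data.Integer.Tactic.RingSolver using (solve-∀)
open import Data.Nat.Base as ℕ using (ℕ; zero; suc; _!; NonZero)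
open import Data.Nat.Divisibility as ℕ∣ using (divides)
open import Data.Nat.Primality using (Prime; euclidsLemma; prime⇒nonZero; prime⇒nonTrivial)
import Data.Nat.Properties as ℕ
open import Data.Product.Base using (_×_; _,_)
open import Data.Sum.Base using (inj₁; inj₂)
open import Data.Vec.Functional using (Vector)
open import Level using (0ℓ)
open import Relation.Binary.PropositionalEquality
open import Relation.Nullary using (¬_; yes; no; contradiction)

module PowerSeries (R : CommutativeRing 0ℓ 0ℓ) where
  open CommutativeRing R
  open RawSemiringDefinitions (Semiring.rawSemiring semiring) using (sum)

  Series : Set
  Series = ℕ → Carrier

  infix 4 _≋_
  _≋_ : Series → Series → Set
  a ≋ b = ∀ n → a n ≈ b n

  const : Carrier → Series
  const c zero    = c
  const c (suc _) = 0#

  1ₛ : Series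
  1ₛ = const 1#

  infixl 6 _-ₛ_
  _-ₛ_ : Series → Series → Series
  (a -ₛ b) n = a n - b n

  infixl 7 _*ₛ_
  _*ₛ_ : Series → Series → Series
  (a *ₛ b) n = sum {suc n} λ i → a (toℕ i) * b (n ℕ.∸ toℕ i)

  infixr 7 _·ₛ_
  _·ₛ_ : Carrier → Series → Series
  (c ·ₛ a) n = c * a n

  sumₛ : ∀ {t} → Vector Series t → Series
  sumₛ a n = sum λ j → a j n

  IsUnit : Series → Set
  IsUnit = AlgebraDefinitions.Invertible _≋_ 1ₛ _*ₛ_

infix 4 _≡_[mod_]
_≡_[mod_] : ℤ → ℤ → ℤ → Set
a ≡ b [mod m ] = m ∣ℤ a ℤ.- b

module _ {m : ℤ} where

  ≡⇒mod : ∀ {a b} → a ≡ b → a ≡ b [mod m ]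
  ≡⇒mod {a} refl = dividesℤ 0ℤ (ℤ.+-inverseʳ a)

  mod-sym : ∀ {a b} → a ≡ b [mod m ] → b ≡ a [mod m ]
  mod-sym {a} {b} p = subst (m ∣ℤ_) (eq a b) (∣m⇒∣-m p)
    where
    eq : ∀ a b → ℤ.- (a ℤ.- b) ≡ b ℤ.- a
    eq = solve-∀

  mod-trans : ∀ {a b c} → a ≡ b [mod m ] → b ≡ c [mod m ] → a ≡ c [mod m ]
  mod-trans {a} {b} {c} p q = subst (m ∣ℤ_) (eq a b c) (∣m∣n⇒∣m+n p q)
    where
    eq : ∀ a b c → (a ℤ.- b) ℤ.+ (b ℤ.- c) ≡ a ℤ.- c
    eq = solve-∀

  mod-+ : ∀ {a b c d} → a ≡ b [mod m ] → c ≡ d [mod m ] → a ℤ.+ c ≡ b ℤ.+ d [mod m ]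
  mod-+ {a} {b} {c} {d} p q = subst (m ∣ℤ_) (eq a b c d) (∣m∣n⇒∣m+n p q)
    where
    eq : ∀ a b c d → (a ℤ.- b) ℤ.+ (c ℤ.- d) ≡ (a ℤ.+ c) ℤ.- (b ℤ.+ d)
    eq = solve-∀

  mod-neg : ∀ {a b} → a ≡ b [mod m ] → ℤ.- a ≡ ℤ.- b [mod m ]
  mod-neg {a} {b} p = subst (m ∣ℤ_) (eq a b) (∣m⇒∣-m p)
    where
    eq : ∀ a b → ℤ.- (a ℤ.- b) ≡ (ℤ.- a) ℤ.- (ℤ.- b)
    eq = solve-∀

  mod-* : ∀ {a b c d} → a ≡ b [mod m ] → c ≡ d [mod m ] → a ℤ.* c ≡ b ℤ.* d [mod m ]
  mod-* {a} {b} {c} {d} p q =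
    subst (m ∣ℤ_) (eq a b c d) (∣m∣n⇒∣m+n (∣m⇒∣m*n c p) (∣n⇒∣m*n b q))
    where
    eq : ∀ a b c d → (a ℤ.- b) ℤ.* c ℤ.+ b ℤ.* (c ℤ.- d) ≡ a ℤ.* c ℤ.- b ℤ.* d
    eq = solve-∀

fallingℤ : ℤ → ℕ → ℤ
fallingℤ a zero    = 1ℤ
fallingℤ a (suc n) = fallingℤ a n ℤ.* (a ℤ.- + n)

module _ where
  private
    shift : ∀ a n → fallingℤ (1ℤ ℤ.+ a) (suc n) ≡ (1ℤ ℤ.+ a) ℤ.* fallingℤ a n
    shift a zero    = eq a
      where
      eq : ∀ a → 1ℤ ℤ.* (1ℤ ℤ.+ a ℤ.- + 0) ≡ (1ℤ ℤ.+ a) ℤ.* 1ℤ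
      eq = solve-∀
    shift a (suc n) = trans
      (cong (ℤ._* (1ℤ ℤ.+ a ℤ.- + suc n)) (shift a n))
      (eq a (fallingℤ a n) (+ n))
      where
      eq : ∀ a x k → (1ℤ ℤ.+ a) ℤ.* x ℤ.* (1ℤ ℤ.+ a ℤ.- (1ℤ ℤ.+ k)) ≡ (1ℤ ℤ.+ a) ℤ.* (x ℤ.* (a ℤ.- k))
      eq = solve-∀

    difference : ∀ a n → fallingℤ (1ℤ ℤ.+ a) (suc n) ≡ fallingℤ a (suc n) ℤ.+ + suc n ℤ.* fallingℤ a n
    difference a n = trans (shift a n) (eq a (fallingℤ a n) (+ n))
      where
      eq : ∀ a x k → (1ℤ ℤ.+ a) ℤ.* x ≡ x ℤ.* (a ℤ.- k) ℤ.+ (1ℤ ℤ.+ k) ℤ.* x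
      eq = solve-∀

    falling0 : ∀ n → fallingℤ 0ℤ (suc n) ≡ 0ℤ
    falling0 zero    = refl
    falling0 (suc n) = cong (ℤ._* (0ℤ ℤ.- + suc n)) (falling0 n)

    step : ∀ n a → + (n !) ∣ℤ fallingℤ a n → + (suc n !) ∣ℤ + suc n ℤ.* fallingℤ a n
    step n a p = subst (_∣ℤ + suc n ℤ.* fallingℤ a n) (sym (ℤ.pos-* (suc n) (n !)))
                   (*-monoʳ-∣ (+ suc n) p)

  !∣falling : ∀ n a → + (n !) ∣ℤ fallingℤ a n
  !∣falling zero    a            = dividesℤ 1ℤ refl
  !∣falling (suc n) (+ zero)     = dividesℤ 0ℤ (falling0 n)
  !∣falling (suc n) (+ suc a)    = subst (+ (suc n !) ∣ℤ_) (sym (difference (+ a) n))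
    (∣m∣n⇒∣m+n (!∣falling (suc n) (+ a)) (step n (+ a) (!∣falling n (+ a))))
  !∣falling (suc n) -[1+ zero ]  = ∣m+n∣n⇒∣m
    (subst (+ (suc n !) ∣ℤ_) (difference -[1+ 0 ] n) (!∣falling (suc n) 0ℤ))
    (step n -[1+ 0 ] (!∣falling n -[1+ 0 ]))
  !∣falling (suc n) -[1+ suc a ] = ∣m+n∣n⇒∣m
    (subst (+ (suc n !) ∣ℤ_) (difference -[1+ suc a ] n) (!∣falling (suc n) -[1+ a ]))
    (step n -[1+ suc a ] (!∣falling n -[1+ suc a ]))

binomialℤ : ℤ → ℕ → ℤ
binomialℤ a n = _∣ℤ_.quotient (!∣falling n a)

binomialℤ-spec : ∀ a n → fallingℤ a n ≡ binomialℤ a n ℤ.* + (n !)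
binomialℤ-spec a n = _∣ℤ_.equality (!∣falling n a)

module AdicIntegers (ℓ : ℕ) where

  -- An element of lim ℤ/ℓⁿ, given by an integer representative at each level;
  -- the level-n representative matters only modulo ℓⁿ.
  record ℤₗ : Set where
    field
      rep      : ℕ → ℤ
      coherent : ∀ n → rep (suc n) ≡ rep n [mod + (ℓ ℕ.^ n) ]
  open ℤₗ public

  infix 4 _≈_
  record _≈_ (x y : ℤₗ) : Set where
    constructor mk≈
    field at : ∀ n → rep x n ≡ rep y n [mod + (ℓ ℕ.^ n) ]
  open _≈_ public

  ι : ℤ → ℤₗ
  ι a .rep _      = a
  ι a .coherent _ = ≡⇒mod {a = a} refl

  infixl 6 _+_
  _+_ : ℤₗ → ℤₗ → ℤₗ
  (x + y) .rep n      = rep x n ℤ.+ rep y n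
  (x + y) .coherent n = mod-+ {a = rep x (suc n)} {b = rep x n} (coherent x n) (coherent y n)

  infixl 7 _*_
  _*_ : ℤₗ → ℤₗ → ℤₗ
  (x * y) .rep n      = rep x n ℤ.* rep y n
  (x * y) .coherent n = mod-* {a = rep x (suc n)} {b = rep x n} (coherent x n) (coherent y n)

  infix 8 -_
  -_ : ℤₗ → ℤₗ
  (- x) .rep n      = ℤ.- rep x n
  (- x) .coherent n = mod-neg {a = rep x (suc n)} {b = rep x n} (coherent x n)

  ℤₗ-commutativeRing : CommutativeRing 0ℓ 0ℓ
  ℤₗ-commutativeRing = record
    { Carrier = ℤₗ ; _≈_ = _≈_ ; _+_ = _+_ ; _*_ = _*_ ; -_ = -_ ; 0# = ι 0ℤ ; 1# = ι 1ℤ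
    ; isCommutativeRing = record
      { isRing = record
        { +-isAbelianGroup = record
          { isGroup = record
            { isMonoid = record
              { isSemigroup = record
                { isMagma = record
                  { isEquivalence = record
                    { refl  = pointwise λ _ → refl
                    ; sym   = λ {x} {y} p → mk≈ λ n → mod-sym {a = rep x n} {b = rep y n} (at p n)
                    ; trans = λ {x} {y} {z} p q → mk≈ λ n →
                        mod-trans {a = rep x n} {b = rep y n} {c = rep z n} (at p n) (at q n)
                    }
                  ; ∙-cong = λ {x} {y} p q → mk≈ λ n →
                      mod-+ {a = rep x n} {b = rep y n} (at p n) (at q n)
                  }
                ; assoc = λ x y z → pointwise λ n → ℤ.+-assoc (rep x n) (rep y n) (rep z n)
                }
              ; identity = (λ x → pointwise λ n → ℤ.+-identityˡ (rep x n))
                         , (λ x → pointwise λ n → ℤ.+-identityʳ (rep x n))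
              }
            ; inverse = (λ x → pointwise λ n → ℤ.+-inverseˡ (rep x n))
                      , (λ x → pointwise λ n → ℤ.+-inverseʳ (rep x n))
            ; ⁻¹-cong = λ {x} {y} p → mk≈ λ n → mod-neg {a = rep x n} {b = rep y n} (at p n)
            }
          ; comm = λ x y → pointwise λ n → ℤ.+-comm (rep x n) (rep y n)
          }
        ; *-cong = λ {x} {y} p q → mk≈ λ n →
            mod-* {a = rep x n} {b = rep y n} (at p n) (at q n)
        ; *-assoc = λ x y z → pointwise λ n → ℤ.*-assoc (rep x n) (rep y n) (rep z n)
        ; *-identity = (λ x → pointwise λ n → ℤ.*-identityˡ (rep x n))
                     , (λ x → pointwise λ n → ℤ.*-identityʳ (rep x n))
        ; distrib = (λ x y z → pointwise λ n → ℤ.*-distribˡ-+ (rep x n) (rep y n) (rep z n))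
                  , (λ x y z → pointwise λ n → ℤ.*-distribʳ-+ (rep x n) (rep y n) (rep z n))
        }
      ; *-comm = λ x y → pointwise λ n → ℤ.*-comm (rep x n) (rep y n)
      }
    }
    where
    pointwise : ∀ {x y} → (∀ n → rep x n ≡ rep y n) → x ≈ y
    pointwise {x} {y} p = mk≈ λ n → ≡⇒mod {a = rep x n} {b = rep y n} (p n)

  falling : ℤₗ → ℕ → ℤₗ
  falling b zero    = ι 1ℤ
  falling b (suc n) = falling b n * (b + - ι (+ n))

  rep-falling : ∀ b n k → rep (falling b n) k ≡ fallingℤ (rep b k) n
  rep-falling b zero    k = refl
  rep-falling b (suc n) k = cong (ℤ._* (rep b k ℤ.- + n)) (rep-falling b n k)

  coherent⁺ : ∀ x k j → rep x (k ℕ.+ j) ≡ rep x k [mod + (ℓ ℕ.^ k) ]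
  coherent⁺ x k zero    = ≡⇒mod (cong (rep x) (ℕ.+-identityʳ k))
  coherent⁺ x k (suc j) = subst (λ i → rep x i ≡ rep x k [mod + (ℓ ℕ.^ k) ]) (sym (ℕ.+-suc k j))
    (mod-trans {a = rep x (suc (k ℕ.+ j))} {b = rep x (k ℕ.+ j)} {c = rep x k}
      (∣-trans (∣ᵤ⇒∣ (subst (ℓ ℕ.^ k ℕ∣.∣_) (sym (ℕ.^-distribˡ-+-* ℓ k j)) (ℕ∣.m∣m*n (ℓ ℕ.^ j))))
               (coherent x (k ℕ.+ j)))
      (coherent⁺ x k j))

module Cancellation {ℓ : ℕ} (ℓ-prime : Prime ℓ) where
  private instance
    ℓ≢0 : NonZero ℓ
    ℓ≢0 = prime⇒nonZero ℓ-prime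

  ^-cancel-coprime : ∀ j m d → ¬ ℓ ℕ∣.∣ m → ℓ ℕ.^ j ℕ∣.∣ m ℕ.* d → ℓ ℕ.^ j ℕ∣.∣ d
  ^-cancel-coprime zero    m d ℓ∤m _ = ℕ∣.1∣ d
  ^-cancel-coprime (suc j) m d ℓ∤m p
    with euclidsLemma m d ℓ-prime (ℕ∣.∣-trans (ℕ∣.m∣m*n (ℓ ℕ.^ j)) p)
  ... | inj₁ ℓ∣m             = contradiction ℓ∣m ℓ∤m
  ... | inj₂ (divides c refl) = subst (ℓ ℕ.^ suc j ℕ∣.∣_) (ℕ.*-comm ℓ c)
    (ℕ∣.*-monoʳ-∣ ℓ (^-cancel-coprime j m c ℓ∤m
      (ℕ∣.*-cancelˡ-∣ ℓ (subst (ℓ ℕ.^ suc j ℕ∣.∣_) eq p))))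
    where
    eq : m ℕ.* (c ℕ.* ℓ) ≡ ℓ ℕ.* (m ℕ.* c)
    eq = trans (sym (ℕ.*-assoc m c ℓ)) (ℕ.*-comm (m ℕ.* c) ℓ)

  ^-cancel : ∀ e k m d .{{_ : NonZero m}} → m ℕ.< ℓ ℕ.^ e →
             ℓ ℕ.^ (k ℕ.+ e) ℕ∣.∣ m ℕ.* d → ℓ ℕ.^ k ℕ∣.∣ d
  ^-cancel zero    k (suc m) d (ℕ.s≤s ()) p
  ^-cancel (suc e) k m d m<ℓ^e p with ℓ ℕ∣.∣? m
  ... | no ℓ∤m = ℕ∣.∣-trans
    (subst (ℓ ℕ.^ k ℕ∣.∣_) (sym (ℕ.^-distribˡ-+-* ℓ k (suc e))) (ℕ∣.m∣m*n (ℓ ℕ.^ suc e)))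
    (^-cancel-coprime (k ℕ.+ suc e) m d ℓ∤m p)
  ... | yes (divides c refl) = ^-cancel e k c d {{ℕ.m*n≢0⇒m≢0 c}}
    (ℕ.*-cancelˡ-< ℓ c (ℓ ℕ.^ e) (subst (ℕ._< ℓ ℕ.^ suc e) (ℕ.*-comm c ℓ) m<ℓ^e))
    (ℕ∣.*-cancelˡ-∣ ℓ (subst₂ ℕ∣._∣_ (cong (ℓ ℕ.^_) (ℕ.+-suc k e)) eq p))
    where
    eq : c ℕ.* ℓ ℕ.* d ≡ ℓ ℕ.* (c ℕ.* d)
    eq = trans (cong (ℕ._* d) (ℕ.*-comm c ℓ)) (ℕ.*-assoc ℓ c d)

  n<ℓ^n : ∀ n → n ℕ.< ℓ ℕ.^ n
  n<ℓ^n zero    = ℕ.s≤s ℕ.z≤n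
  n<ℓ^n (suc n) = ℕ.<-≤-trans
    (ℕ.s≤s (n<ℓ^n n))
    (ℕ.^-monoʳ-< ℓ (ℕ.nonTrivial⇒n>1 ℓ {{prime⇒nonTrivial ℓ-prime}}) (ℕ.n<1+n n))

  cancel : ∀ k m .{{_ : NonZero m}} z → + (ℓ ℕ.^ (k ℕ.+ m)) ∣ℤ z ℤ.* + m → + (ℓ ℕ.^ k) ∣ℤ z
  cancel k m z p = ∣ᵤ⇒∣ (^-cancel m k m ℤ.∣ z ∣ (n<ℓ^n m)
    (subst (ℓ ℕ.^ (k ℕ.+ m) ℕ∣.∣_) (trans (ℤ.abs-* z (+ m)) (ℕ.*-comm ℤ.∣ z ∣ m)) (∣⇒∣ᵤ p)))

module Bouquet (ℓ : ℕ) (ℓ-prime : Prime ℓ) where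
  open AdicIntegers ℓ public
  open PowerSeries ℤₗ-commutativeRing public
  open RawSemiringDefinitions (Semiring.rawSemiring (CommutativeRing.semiring ℤₗ-commutativeRing)) using (_∣_; _^_)
  open Cancellation ℓ-prime

  private
    fallingℤ-cong : ∀ {m a b} n → a ≡ b [mod m ] → fallingℤ a n ≡ fallingℤ b n [mod m ]
    fallingℤ-cong zero _ = ≡⇒mod {a = 1ℤ} refl
    fallingℤ-cong {m} {a} {b} (suc n) p =
      mod-* {a = fallingℤ a n} {b = fallingℤ b n} (fallingℤ-cong n p)
        (mod-+ {a = a} {b = b} p (≡⇒mod {a = ℤ.- + n} refl))

  -- Dividing by n! loses at most v_ℓ(n!) ≤ n! digits of precision, hence the
  -- shifted index; binomial-spec characterises the result as b(b-1)⋯(b-n+1)/n!.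
  binomial : ℤₗ → ℕ → ℤₗ
  binomial b n .rep k      = binomialℤ (rep b (k ℕ.+ n !)) n
  binomial b n .coherent k = cancel k (n !) {{ℕ.>-nonZero (ℕ.1≤n! n)}} (y′ ℤ.- y)
    (subst (+ (ℓ ℕ.^ (k ℕ.+ n !)) ∣ℤ_)
      (trans (cong₂ ℤ._-_ (binomialℤ-spec x′ n) (binomialℤ-spec x n)) (eq y′ y (+ (n !))))
      (fallingℤ-cong {a = x′} {b = x} n (coherent b (k ℕ.+ n !))))
    where
    x  = rep b (k ℕ.+ n !)
    x′ = rep b (suc k ℕ.+ n !)
    y  = binomialℤ x n
    y′ = binomialℤ x′ n
    eq : ∀ a b c → a ℤ.* c ℤ.- b ℤ.* c ≡ (a ℤ.- b) ℤ.* c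
    eq = solve-∀

  binomial-spec : ∀ b n → binomial b n * ι (+ (n !)) ≈ falling b n
  binomial-spec b n = mk≈ λ k →
    subst₂ (λ x y → x ≡ y [mod + (ℓ ℕ.^ k) ])
      (binomialℤ-spec (rep b (k ℕ.+ n !)) n) (sym (rep-falling b n k))
      (fallingℤ-cong {a = rep b (k ℕ.+ n !)} {b = rep b k} n (coherent⁺ b k (n !)))

  [1+T]^_ : ℤₗ → Series
  [1+T]^ b = binomial b

  characteristicSeries : ∀ {t} → Vector ℤₗ t → Series
  characteristicSeries α = sumₛ λ j → const (ι (+ 2)) -ₛ [1+T]^ (α j) -ₛ [1+T]^ (- α j)

  Admissible : ∀ {t} → Vector ℤₗ t → Set
  Admissible α = ¬ (∀ j → ι (+ ℓ) ∣ α j)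

  record IsDistinguished (d : ℕ) (g : Series) : Set where
    field
      monic     : g d ≈ ι 1ℤ
      degree≤   : ∀ n → d ℕ.< n → g n ≈ ι 0ℤ
      divisible : ∀ n → n ℕ.< d → ι (+ ℓ) ∣ g n

  record WeierstrassFactorisation (f : Series) : Set where
    field
      μ             : ℕ
      deg           : ℕ
      g             : Series
      u             : Series
      distinguished : IsDistinguished deg g
      unit          : IsUnit u
      factorisation : f ≋ (ι (+ ℓ) ^ μ) ·ₛ (g *ₛ u)

  -- By uniqueness in Weierstrass preparation, μ and deg do not depend on the
  -- factorisation.  Finding one for an arbitrary nonzero series is not
  -- constructive, so the invariants take the factorisation as an argument.
  module _ {t} (α : Vector ℤₗ t) (W : WeierstrassFactorisation (characteristicSeries α)) where
    open WeierstrassFactorisation W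

    μ-invariant : ℕ
    μ-invariant = μ

    λ-invariant : ℤ
    λ-invariant = + deg ℤ.- 1ℤ

{-# OPTIONS --safe #-}

-- Write S(h) = Σ_j (h(α_j) + h(-α_j)).  For n ≥ 1, -n! f_n is S of the n-th
-- falling factorial.  If deg g > 2t, then ℓ divides f_n for all n ≤ 2t, hence S
-- kills modulo ℓ every integer polynomial of degree at most 2t without constant
-- term.  If b = α_i were nonzero modulo ℓ, take
-- h = x (x + b) Π (x - α_j)(x + α_j) over the j with α_j ≢ ±b: its degree is at
-- most 2t, and S(h) ≡ k h(b), where k counts the j with α_j ≡ ±b.  As
-- 0 < k ≤ t < ℓ and ℓ is odd, k h(b) is nonzero modulo ℓ.

module Submission where

open import Defs
open import Algebra.Bundles using (CommutativeRing; Semiring)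
open import Algebra.Definitions.RawMagma using (_,_)
import Algebra.Definitions.RawSemiring as RawSemiringDefinitions
import Algebra.Properties.Semiring.Sum as SemiringSum
open import Data.Fin.Base as Fin using (toℕ)
import Data.Fin.Properties as Fin
open import Data.Integer.Base as ℤ using (ℤ; +_; 0ℤ; 1ℤ) renaming (_<_ to _<ℤ_)
open import Data.Integer.Divisibility.Signed
  using (∣ᵤ⇒∣; ∣⇒∣ᵤ; _∣?_; ∣m∣n⇒∣m+n; ∣m⇒∣m*n; ∣n⇒∣m*n; *-cancelˡ-∣)
  renaming (_∣_ to _∣ℤ_; divides to dividesℤ)
import Data.Integer.Properties as ℤ
open import Data.Integer.Tactic.RingSolver using (solve-∀)
open import Data.List.Base using (List; []; _∷_; length)
open import Data.List.Membership.Propositional using (_∈_)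
open import Data.List.Relation.Unary.All using (All; []; _∷_)
open import Data.List.Relation.Unary.Any using (here; there)
open import Data.Nat.Base as ℕ using (ℕ; zero; suc; _≤_; _<_; _*_; _!)
open import Data.Nat.Divisibility using (_∣_; ∣⇒≤; ∣-refl)
open import Data.Nat.Primality using (Prime; euclidsLemma; prime⇒nonZero; prime⇒nonTrivial)
import Data.Nat.Properties as ℕ
open import Data.Sum.Base using (_⊎_; inj₁; inj₂)
open import Data.Vec.Functional using (Vector; tail)
open import Function.Base using (_∘_)
open import Relation.Binary.PropositionalEquality
open import Relation.Nullary using (¬_; yes; no; contradiction)

open SemiringSum ℤ.+-*-semiring using (sum; sum-cong-≗; ∑-distrib-+; *-distribˡ-sum)

-- Divisibility of integers, and by a prime.

∣-sum : ∀ {m n} (v : Vector ℤ n) → (∀ i → m ∣ℤ v i) → m ∣ℤ sum v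
∣-sum {n = zero}  v p = dividesℤ 0ℤ refl
∣-sum {n = suc n} v p = ∣m∣n⇒∣m+n (p Fin.zero) (∣-sum (tail v) (p ∘ Fin.suc))

sum-mod : ∀ {m n} (v w : Vector ℤ n) → (∀ i → v i ≡ w i [mod m ]) → sum v ≡ sum w [mod m ]
sum-mod {n = zero}  v w p = dividesℤ 0ℤ refl
sum-mod {n = suc n} v w p =
  mod-+ {a = v Fin.zero} {b = w Fin.zero} (p Fin.zero) (sum-mod (tail v) (tail w) (p ∘ Fin.suc))

∣-resp-mod : ∀ {m a b} → m ∣ℤ a ℤ.- b → m ∣ℤ b → m ∣ℤ a
∣-resp-mod {m} {a} {b} p q = subst (m ∣ℤ_) (eq a b) (∣m∣n⇒∣m+n p q)
  where
  eq : ∀ a b → a ℤ.- b ℤ.+ b ≡ a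
  eq = solve-∀

prime-∣-* : ∀ {p} → Prime p → ∀ a b → + p ∣ℤ a ℤ.* b → + p ∣ℤ a ⊎ + p ∣ℤ b
prime-∣-* {p} p-prime a b d
  with euclidsLemma ℤ.∣ a ∣ ℤ.∣ b ∣ p-prime (subst (p ∣_) (ℤ.abs-* a b) (∣⇒∣ᵤ d))
... | inj₁ p∣a = inj₁ (∣ᵤ⇒∣ p∣a)
... | inj₂ p∣b = inj₂ (∣ᵤ⇒∣ p∣b)

prime-∤-* : ∀ {p} → Prime p → ∀ {a b} → ¬ + p ∣ℤ a → ¬ + p ∣ℤ b → ¬ + p ∣ℤ a ℤ.* b
prime-∤-* p-prime {a} {b} p∤a p∤b d with prime-∣-* p-prime a b d
... | inj₁ p∣a = p∤a p∣a
... | inj₂ p∣b = p∤b p∣b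

-- Symmetric sums and polynomials given by their roots.

symmetricSum : ∀ {t} → Vector ℤ t → (ℤ → ℤ) → ℤ
symmetricSum a h = sum λ j → h (a j) ℤ.+ h (ℤ.- a j)

withRoots : List ℤ → ℤ → ℤ
withRoots []       x = 1ℤ
withRoots (v ∷ vs) x = (x ℤ.- v) ℤ.* withRoots vs x

withRoots-root : ∀ {v vs} → v ∈ vs → withRoots vs v ≡ 0ℤ
withRoots-root {v} {vs = _ ∷ vs} (here refl) = cong (ℤ._* withRoots vs v) (ℤ.+-inverseʳ v)
withRoots-root {v} {vs = w ∷ vs} (there p)   =
  trans (cong ((v ℤ.- w) ℤ.*_) (withRoots-root p)) (ℤ.*-zeroʳ (v ℤ.- w))

withRoots-∤ : ∀ {p x} → Prime p → ∀ {vs} → All (λ v → ¬ + p ∣ℤ x ℤ.- v) vs → ¬ + p ∣ℤ withRoots vs x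
withRoots-∤ {p} p-prime []           p∣1 = contradiction (ℕ.nonTrivial⇒n>1 p {{prime⇒nonTrivial p-prime}})
  (ℕ.≤⇒≯ (∣⇒≤ (∣⇒∣ᵤ p∣1)))
withRoots-∤     p-prime (p∤ ∷ p∤vs)      = prime-∤-* p-prime p∤ (withRoots-∤ p-prime p∤vs)

-- The one trace of having integer coefficients that is kept: collapsing a symmetric sum modulo `m`
-- uses only that congruences are preserved.
RespectsMod : ℤ → (ℤ → ℤ) → Set
RespectsMod m h = ∀ x y → x ≡ y [mod m ] → h x ≡ h y [mod m ]

withRoots-respectsMod : ∀ {m} vs → RespectsMod m (withRoots vs)
withRoots-respectsMod []       x y p = ≡⇒mod {a = 1ℤ} refl
withRoots-respectsMod (v ∷ vs) x y p =
  mod-* {a = x ℤ.- v} {b = y ℤ.- v} (mod-+ {a = x} {b = y} p (≡⇒mod {a = ℤ.- v} refl))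
    (withRoots-respectsMod vs x y p)

-- Reduces the number of roots by x - v = (x - n) + (n - v), as falling
-- factorials absorb the factor x - n.
∣-symmetricSum-withRoots : ∀ {m d t} (a : Vector ℤ t) →
  (∀ n → 1 ≤ n → n ≤ d → m ∣ℤ symmetricSum a λ x → fallingℤ x n) →
  ∀ vs n → 1 ≤ n → n ℕ.+ length vs ≤ d → m ∣ℤ symmetricSum a λ x → fallingℤ x n ℤ.* withRoots vs x
∣-symmetricSum-withRoots {m} a p [] n 1≤n n≤d = subst (m ∣ℤ_)
  (sum-cong-≗ λ j → sym (cong₂ ℤ._+_ (ℤ.*-identityʳ (fallingℤ (a j) n)) (ℤ.*-identityʳ (fallingℤ (ℤ.- a j) n))))
  (p n 1≤n (subst (_≤ _) (ℕ.+-identityʳ n) n≤d))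
∣-symmetricSum-withRoots {m} {d} a p (v ∷ vs) n 1≤n n≤d = subst (m ∣ℤ_) (sym split)
  (∣m∣n⇒∣m+n
    (∣-symmetricSum-withRoots a p vs (suc n) (ℕ.s≤s ℕ.z≤n) n+1≤d)
    (∣n⇒∣m*n (+ n ℤ.- v) (∣-symmetricSum-withRoots a p vs n 1≤n (ℕ.≤-trans (ℕ.n≤1+n _) n+1≤d))))
  where
  n+1≤d : suc n ℕ.+ length vs ≤ d
  n+1≤d = subst (_≤ d) (ℕ.+-suc n (length vs)) n≤d

  F : ℕ → List ℤ → ℤ → ℤ
  F n vs x = fallingℤ x n ℤ.* withRoots vs x

  eq : ∀ n v x f r y g s →
       f ℤ.* ((x ℤ.- v) ℤ.* r) ℤ.+ g ℤ.* ((y ℤ.- v) ℤ.* s) ≡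
       (f ℤ.* (x ℤ.- n) ℤ.* r ℤ.+ g ℤ.* (y ℤ.- n) ℤ.* s) ℤ.+ (n ℤ.- v) ℤ.* (f ℤ.* r ℤ.+ g ℤ.* s)
  eq = solve-∀

  split : symmetricSum a (F n (v ∷ vs)) ≡
          symmetricSum a (F (suc n) vs) ℤ.+ (+ n ℤ.- v) ℤ.* symmetricSum a (F n vs)
  split = trans
    (sum-cong-≗ λ j → eq (+ n) v (a j) (fallingℤ (a j) n) (withRoots vs (a j))
                         (ℤ.- a j) (fallingℤ (ℤ.- a j) n) (withRoots vs (ℤ.- a j)))
    (trans
      (∑-distrib-+ (λ j → F (suc n) vs (a j) ℤ.+ F (suc n) vs (ℤ.- a j))
                   (λ j → (+ n ℤ.- v) ℤ.* (F n vs (a j) ℤ.+ F n vs (ℤ.- a j))))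
      (cong (ℤ._+_ (symmetricSum a (F (suc n) vs)))
        (sym (*-distribˡ-sum (+ n ℤ.- v) (λ j → F n vs (a j) ℤ.+ F n vs (ℤ.- a j))))))

-- Sorting the entries by agreement with `b` up to sign.

-- As built by `partition`, `count` is the number of indices whose entry is congruent to `b` or to
-- its negative; every other index puts both its entry and the negative into `others`. Hence `total`
-- controls the number of roots as well as `count`.
record Partition (m b : ℤ) {t} (a : Vector ℤ t) : Set where
  field
    count      : ℕ
    others     : List ℤ
    total      : length others ℕ.+ 2 * count ≡ 2 * t
    separated  : All (λ v → ¬ b ≡ v [mod m ]) others
    inhabited  : ∀ j → b ≡ a j [mod m ] → 0 < count
    evaluation : ∀ h → RespectsMod m h → (∀ {v} → v ∈ ℤ.- b ∷ others → m ∣ℤ h v) →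
                 symmetricSum a h ≡ + count ℤ.* h b [mod m ]

-- Of the pair, `x` agrees with `b`, while its negative agrees with the negative of `b`, where `h`
-- vanishes modulo `m`.
paired-values : ∀ {m b x} h → RespectsMod m h → m ∣ℤ h (ℤ.- b) →
                b ≡ x [mod m ] → h x ℤ.+ h (ℤ.- x) ≡ h b [mod m ]
paired-values {m} {b} {x} h resp zero-at--b b≡x =
  subst (m ∣ℤ_) (eq (h x) (h (ℤ.- x)) (h b)) (∣m∣n⇒∣m+n (resp x b x≡b)
    (∣-resp-mod {a = h (ℤ.- x)} {b = h (ℤ.- b)} (resp (ℤ.- x) (ℤ.- b) (mod-neg {a = x} {b = b} x≡b)) zero-at--b))
  where
  x≡b = mod-sym {a = b} {b = x} b≡x

  eq : ∀ y z w → (y ℤ.- w) ℤ.+ z ≡ y ℤ.+ z ℤ.- w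
  eq = solve-∀

double-suc : ∀ k → 2 * suc k ≡ suc (suc (2 * k))
double-suc k = cong suc (ℕ.+-suc k (k ℕ.+ 0))

module _ {m b : ℤ} {t} {a : Vector ℤ (suc t)} (P : Partition m b (tail a)) where
  open Partition P

  private
    a₀ = a Fin.zero

  count-head : b ≡ a₀ [mod m ] ⊎ b ≡ ℤ.- a₀ [mod m ] → Partition m b a
  count-head b≡±a₀ = record
    { count      = suc count
    ; others     = others
    ; total      = trans (cong (length others ℕ.+_) (double-suc count))
                     (trans (ℕ.+-suc _ _) (trans (cong suc (ℕ.+-suc _ _))
                       (trans (cong (suc ∘ suc) total) (sym (double-suc t)))))
    ; separated  = separated
    ; inhabited  = λ _ _ → ℕ.s≤s ℕ.z≤n
    ; evaluation = λ h resp zeros →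
        subst (λ s → symmetricSum a h ≡ s [mod m ]) (eq (+ count) (h b))
          (mod-+ {a = h a₀ ℤ.+ h (ℤ.- a₀)} {b = h b} (head-value h resp (zeros (here refl)) b≡±a₀)
            (evaluation h resp zeros))
    }
    where
    eq : ∀ k y → y ℤ.+ k ℤ.* y ≡ (1ℤ ℤ.+ k) ℤ.* y
    eq = solve-∀

    head-value : ∀ h → RespectsMod m h → m ∣ℤ h (ℤ.- b) → b ≡ a₀ [mod m ] ⊎ b ≡ ℤ.- a₀ [mod m ] →
                 h a₀ ℤ.+ h (ℤ.- a₀) ≡ h b [mod m ]
    head-value h resp z (inj₁ b≡a₀)  = paired-values h resp z b≡a₀
    -- The pair of the negative of `a₀` is the pair of `a₀` in the other order.
    head-value h resp z (inj₂ b≡-a₀) = subst (λ s → s ≡ h b [mod m ])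
      (trans (ℤ.+-comm (h (ℤ.- a₀)) _) (cong (λ x → h x ℤ.+ h (ℤ.- a₀)) (ℤ.neg-involutive a₀)))
      (paired-values h resp z b≡-a₀)

  -- Both members of the new pair become prescribed roots, so the head adds nothing to the sum
  -- modulo `m`.
  separate-head : ¬ b ≡ a₀ [mod m ] → ¬ b ≡ ℤ.- a₀ [mod m ] → Partition m b a
  separate-head b≢a₀ b≢-a₀ = record
    { count      = count
    ; others     = a₀ ∷ ℤ.- a₀ ∷ others
    ; total      = trans (cong (suc ∘ suc) total) (sym (double-suc t))
    ; separated  = b≢a₀ ∷ b≢-a₀ ∷ separated
    ; inhabited  = λ { Fin.zero b≡a₀ → contradiction b≡a₀ b≢a₀ ; (Fin.suc j) → inhabited j }
    ; evaluation = λ h resp zeros →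
        subst (m ∣ℤ_) (sym (ℤ.+-assoc (h a₀ ℤ.+ h (ℤ.- a₀)) (symmetricSum (tail a) h) (ℤ.- (+ count ℤ.* h b))))
          (∣m∣n⇒∣m+n
            (∣m∣n⇒∣m+n (zeros (there (here refl))) (zeros (there (there (here refl)))))
            (evaluation h resp λ { (here refl) → zeros (here refl) ; (there v∈) → zeros (there (there (there v∈))) }))
    }

partition : ∀ m b {t} (a : Vector ℤ t) → Partition m b a
partition m b {zero}  a = record
  { count = 0 ; others = [] ; total = refl ; separated = [] ; inhabited = λ ()
  ; evaluation = λ _ _ _ → dividesℤ 0ℤ refl }
partition m b {suc t} a with m ∣? b ℤ.- a Fin.zero | m ∣? b ℤ.- (ℤ.- a Fin.zero)
... | yes b≡a₀ | _         = count-head (partition m b (tail a)) (inj₁ b≡a₀)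
... | no _     | yes b≡-a₀ = count-head (partition m b (tail a)) (inj₂ b≡-a₀)
... | no b≢a₀  | no b≢-a₀  = separate-head (partition m b (tail a)) b≢a₀ b≢-a₀

∣-symmetricSums⇒∣ : ∀ {p t} → Prime p → ¬ 2 ∣ p → t < p → (a : Vector ℤ t) →
  (∀ n → 1 ≤ n → n ≤ 2 * t → + p ∣ℤ symmetricSum a λ x → fallingℤ x n) →
  ∀ i → + p ∣ℤ a i
∣-symmetricSums⇒∣ {p} {t} p-prime p-odd t<p a p∣sums i with + p ∣? a i
... | yes p∣aᵢ = p∣aᵢ
... | no  p∤aᵢ = contradiction p∣k*hb (prime-∤-* p-prime p∤k p∤hb)
  where
  b = a i
  open Partition (partition (+ p) b a)

  -- The root at the negative of `b` makes each counted pair contribute `h b` exactly once.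
  vs = ℤ.- b ∷ others

  -- The factor `fallingℤ x 1` is `x` itself: it removes the constant term, so that only falling
  -- factorials of positive index occur.
  h : ℤ → ℤ
  h x = fallingℤ x 1 ℤ.* withRoots vs x

  0<count : 0 < count
  0<count = inhabited i (≡⇒mod {a = b} refl)

  -- The two factors beyond `others` are paid for by `2 * count`, which is at least 2.
  degree : 1 ℕ.+ length vs ≤ 2 * t
  degree = ℕ.≤-trans (ℕ.≤-reflexive (ℕ.+-comm 2 (length others)))
    (ℕ.≤-trans (ℕ.+-monoʳ-≤ (length others) (ℕ.*-monoʳ-≤ 2 0<count)) (ℕ.≤-reflexive total))

  count≤t : count ≤ t
  count≤t = ℕ.*-cancelˡ-≤ 2 (subst (2 * count ≤_) total (ℕ.m≤n+m (2 * count) (length others)))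

  h-root : ∀ {v} → v ∈ vs → + p ∣ℤ h v
  h-root {v} v∈vs = ∣n⇒∣m*n (fallingℤ v 1) (subst (+ p ∣ℤ_) (sym (withRoots-root v∈vs)) (dividesℤ 0ℤ refl))

  h-respectsMod : RespectsMod (+ p) h
  h-respectsMod x y x≡y = mod-* {a = fallingℤ x 1} {b = fallingℤ y 1}
    (subst (+ p ∣ℤ_) (eq x y) x≡y) (withRoots-respectsMod vs x y x≡y)
    where
    eq : ∀ x y → x ℤ.- y ≡ 1ℤ ℤ.* (x ℤ.- 0ℤ) ℤ.- 1ℤ ℤ.* (y ℤ.- 0ℤ)
    eq = solve-∀

  p∣k*hb : + p ∣ℤ + count ℤ.* h b
  p∣k*hb = ∣-resp-mod {a = + count ℤ.* h b} {b = symmetricSum a h}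
    (mod-sym {a = symmetricSum a h} (evaluation h h-respectsMod h-root))
    (∣-symmetricSum-withRoots a p∣sums vs 1 ℕ.≤-refl degree)

  p∤k : ¬ + p ∣ℤ + count
  p∤k p∣k = ℕ.<⇒≱ (ℕ.≤-<-trans count≤t t<p) (∣⇒≤ {{ℕ.>-nonZero 0<count}} (∣⇒∣ᵤ p∣k))

  p∤2 : ¬ + p ∣ℤ + 2
  p∤2 p∣2 = p-odd (subst (2 ∣_)
    (ℕ.≤-antisym (ℕ.nonTrivial⇒n>1 p {{prime⇒nonTrivial p-prime}}) (∣⇒≤ (∣⇒∣ᵤ p∣2))) ∣-refl)

  -- Oddness of `p` keeps `b` away from its negative, the one root that `separated` does not cover.
  p∤2b : ¬ b ≡ ℤ.- b [mod + p ]
  p∤2b = prime-∤-* p-prime p∤2 p∤aᵢ ∘ subst (+ p ∣ℤ_) (eq b)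
    where
    eq : ∀ b → b ℤ.- (ℤ.- b) ≡ + 2 ℤ.* b
    eq = solve-∀

  p∤hb : ¬ + p ∣ℤ h b
  p∤hb = prime-∤-* p-prime (p∤aᵢ ∘ subst (+ p ∣ℤ_) (eq b)) (withRoots-∤ {x = b} p-prime {vs} (p∤2b ∷ separated))
    where
    eq : ∀ b → 1ℤ ℤ.* (b ℤ.- 0ℤ) ≡ b
    eq = solve-∀

-- Reduction of ℓ-adic integers modulo ℓ.

module _ (ℓ : ℕ) where
  open AdicIntegers ℓ renaming (_*_ to _*ₗ_)
  open RawSemiringDefinitions (Semiring.rawSemiring (CommutativeRing.semiring ℤₗ-commutativeRing))
    using () renaming (_∣_ to _∣ₗ_; sum to sumₗ)

  rep-sum : ∀ {n} (v : Vector ℤₗ n) k → rep (sumₗ v) k ≡ sum λ i → rep (v i) k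
  rep-sum {zero}  v k = refl
  rep-sum {suc n} v k = cong (ℤ._+_ (rep (v Fin.zero) k)) (rep-sum (tail v) k)

  ≈⇒mod-ℓ : ∀ {x y} → x ≈ y → rep x 1 ≡ rep y 1 [mod + ℓ ]
  ≈⇒mod-ℓ {x} {y} x≈y = subst (λ m → rep x 1 ≡ rep y 1 [mod + m ]) (ℕ.*-identityʳ ℓ) (at x≈y 1)

  ∣ₗ⇒∣rep : ∀ {x} → ι (+ ℓ) ∣ₗ x → + ℓ ∣ℤ rep x 1
  ∣ₗ⇒∣rep {x} (q , qℓ≈x) = ∣-resp-mod {a = rep x 1} {b = rep q 1 ℤ.* + ℓ}
    (mod-sym {a = rep q 1 ℤ.* + ℓ} {b = rep x 1} (≈⇒mod-ℓ {q *ₗ ι (+ ℓ)} {x} qℓ≈x))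
    (dividesℤ (rep q 1) refl)

  -- Division by ℓ costs one digit, so the quotient at level `n` is taken from the representative at
  -- level `suc n`; its coherence follows by cancelling ℓ from that of `x`.
  ∣rep⇒∣ₗ : .{{_ : ℕ.NonZero ℓ}} → ∀ x → + ℓ ∣ℤ rep x 1 → ι (+ ℓ) ∣ₗ x
  ∣rep⇒∣ₗ x ℓ∣x₁ = quotient , mk≈ λ n → subst (λ z → z ≡ rep x n [mod + (ℓ ℕ.^ n) ])
      (_∣ℤ_.equality (ℓ∣rep n)) (coherent x n)
    where
    ℓ∣rep : ∀ n → + ℓ ∣ℤ rep x (suc n)
    ℓ∣rep n = ∣-resp-mod {a = rep x (suc n)} {b = rep x 1}
      (subst (λ m → rep x (suc n) ≡ rep x 1 [mod + m ]) (ℕ.*-identityʳ ℓ) (coherent⁺ x 1 n)) ℓ∣x₁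

    q : ℕ → ℤ
    q n = _∣ℤ_.quotient (ℓ∣rep n)

    eq : ∀ ℓ a b → a ℤ.* ℓ ℤ.- b ℤ.* ℓ ≡ ℓ ℤ.* (a ℤ.- b)
    eq = solve-∀

    quotient : ℤₗ
    quotient .rep        = q
    quotient .coherent n = *-cancelˡ-∣ (+ ℓ) (subst₂ _∣ℤ_ (ℤ.pos-* ℓ (ℓ ℕ.^ n))
      (trans (cong₂ ℤ._-_ (_∣ℤ_.equality (ℓ∣rep (suc n))) (_∣ℤ_.equality (ℓ∣rep n)))
        (eq (+ ℓ) (q (suc n)) (q n)))
      (coherent x (suc n)))

-- Coefficients of the characteristic series modulo ℓ.

module _ (ℓ : ℕ) (ℓ-prime : Prime ℓ) where
  open Bouquet ℓ ℓ-prime renaming (_*_ to _*ₗ_)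
  open RawSemiringDefinitions (Semiring.rawSemiring (CommutativeRing.semiring ℤₗ-commutativeRing))
    using () renaming (_^_ to _^ₗ_)

  rep-binomial : ∀ b n → rep (binomial b n) 1 ℤ.* + (n !) ≡ fallingℤ (rep b 1) n [mod + ℓ ]
  rep-binomial b n = subst (λ z → rep (binomial b n) 1 ℤ.* + (n !) ≡ z [mod + ℓ ])
    (rep-falling b n 1)
    (≈⇒mod-ℓ ℓ {binomial b n *ₗ ι (+ (n !))} {falling b n} (binomial-spec b n))

  -- The factorial enters only as a multiplier of the coefficient, so the argument also covers `n`
  -- with ℓ dividing `n !`.
  ∣-coefficient⇒∣-symmetricSum : ∀ {t} (α : Vector ℤₗ t) n → 1 ≤ n →
    + ℓ ∣ℤ rep (characteristicSeries α n) 1 →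
    + ℓ ∣ℤ symmetricSum (λ j → rep (α j) 1) λ x → fallingℤ x n
  ∣-coefficient⇒∣-symmetricSum {t} α (suc n) _ ℓ∣f = ∣-resp-mod {b = sum λ j → ℤ.- (+ (suc n !)) ℤ.* c j}
      (sum-mod _ _ term)
      (subst (+ ℓ ∣ℤ_) (*-distribˡ-sum (ℤ.- (+ (suc n !))) c)
        (∣n⇒∣m*n (ℤ.- (+ (suc n !))) (subst (+ ℓ ∣ℤ_) (rep-sum ℓ {t} f 1) ℓ∣f)))
    where
    f = λ j → (const (ι (+ 2)) -ₛ [1+T]^ (α j) -ₛ [1+T]^ (- α j)) (suc n)
    B = λ x → rep (binomial x (suc n)) 1
    c = λ j → rep (f j) 1
    F = λ x → fallingℤ (rep x 1) (suc n)

    -- The `0ℤ` is what the constant series 2 contributes in positive degree.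
    eq : ∀ x y k → x ℤ.* k ℤ.+ y ℤ.* k ≡ ℤ.- k ℤ.* (0ℤ ℤ.- x ℤ.- y)
    eq = solve-∀

    term : ∀ j → F (α j) ℤ.+ F (- α j) ≡ ℤ.- (+ (suc n !)) ℤ.* c j [mod + ℓ ]
    term j = subst (λ z → F (α j) ℤ.+ F (- α j) ≡ z [mod + ℓ ]) (eq (B (α j)) (B (- α j)) (+ (suc n !)))
      (mod-sym {a = B (α j) ℤ.* + (suc n !) ℤ.+ B (- α j) ℤ.* + (suc n !)} {b = F (α j) ℤ.+ F (- α j)}
        (mod-+ {a = B (α j) ℤ.* + (suc n !)} {b = F (α j)}
          (rep-binomial (α j) (suc n)) (rep-binomial (- α j) (suc n))))

  module _ {f : Series} (W : WeierstrassFactorisation f) where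
    open WeierstrassFactorisation W
    open IsDistinguished distinguished

    -- Each term of the Cauchy product at `n` contains a coefficient of `g` of index at most `n`,
    -- hence below the leading one and divisible by ℓ.
    ∣-below-degree : ∀ n → n < deg → + ℓ ∣ℤ rep (f n) 1
    ∣-below-degree n n<deg = ∣-resp-mod {a = rep (f n) 1}
      (≈⇒mod-ℓ ℓ {f n} (factorisation n))
      (∣n⇒∣m*n (rep (ι (+ ℓ) ^ₗ μ) 1)
        (subst (+ ℓ ∣ℤ_) (sym (rep-sum ℓ {suc n} (λ i → g (toℕ i) *ₗ u (n ℕ.∸ toℕ i)) 1))
          (∣-sum {n = suc n} _ λ i → ∣m⇒∣m*n (rep (u (n ℕ.∸ toℕ i)) 1)
            (∣ₗ⇒∣rep ℓ (divisible (toℕ i) (ℕ.≤-<-trans (ℕ.≤-pred (Fin.toℕ<n i)) n<deg))))))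

theorem4p13 : (ℓ : ℕ) (ℓ-prime : Prime ℓ) → ¬ (2 ∣ ℓ) →
    (t : ℕ) → 2 ≤ t →
    (α : Vector (AdicIntegers.ℤₗ ℓ) t) → Bouquet.Admissible ℓ ℓ-prime α →
    t < ℓ →
    (W : Bouquet.WeierstrassFactorisation ℓ ℓ-prime (Bouquet.characteristicSeries ℓ ℓ-prime α)) →
    Bouquet.λ-invariant ℓ ℓ-prime α W <ℤ + (2 * t)
theorem4p13 ℓ ℓ-prime ℓ-odd t _ α admissible t<ℓ W with Bouquet.WeierstrassFactorisation.deg W ℕ.≤? 2 * t
-- The shift by one in the λ-invariant turns this weak bound into a strict one.
... | yes deg≤2t = ℤ.<-≤-trans
  (ℤ.i≤pred[j]⇒i<j (ℤ.≤-reflexive (ℤ.+-comm (+ Bouquet.WeierstrassFactorisation.deg W) (ℤ.- 1ℤ))))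
  (ℤ.+≤+ deg≤2t)
... | no  deg≰2t = contradiction (λ j → ∣rep⇒∣ₗ ℓ {{prime⇒nonZero ℓ-prime}} (α j) (ℓ∣α j)) admissible
  where
  -- Here the degree exceeds `2 * t`, so every coefficient of index at most `2 * t` lies below it
  -- and is divisible by ℓ.
  ℓ∣α = ∣-symmetricSums⇒∣ ℓ-prime ℓ-odd t<ℓ (λ j → AdicIntegers.rep (α j) 1) λ n 1≤n n≤2t →
    ∣-coefficient⇒∣-symmetricSum ℓ ℓ-prime α n 1≤n
      (∣-below-degree ℓ ℓ-prime W n (ℕ.≤-<-trans n≤2t (ℕ.≰⇒> deg≰2t)))
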